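{- Let $s_\beta$ be the base phi sum of digits function. Consider the alphabet $\{0,1,2,\dots\}\times\{c_0,c_1,c_2,c_3\}$, writing letters as pairs $(j,c)$, and the morphism $\gamma$ defined for all $j\ge0$ by $\gamma((j,c_0))=(j,c_0)(j,c_1)$, $\gamma((j,c_1))=(j,c_2)(j,c_3)$, $\gamma((j,c_2))=(j+2,c_0)(j+2,c_1)(j+2,c_2)$, $\gamma((j,c_3))=(j+1,c_3)(j+2,c_2)(j+1,c_3)$. Let $x_\gamma=\lim_n\gamma^n((0,c_0))$ be the fixed point of $\gamma$ with initial letter $(0,c_0)$, and let $\delta$ be the morphism from this alphabet to words over the nonnegative integers given by $\delta((j,c_0))=(j,\,j+1)$, $\delta((j,c_1))=(j+2)$, $\delta((j,c_2))=(j+2,\,j+3)$, $\delta((j,c_3))=(j+3,\,j+3)$. Then $\delta(x_\gamma)$ equals the sequence $(s_\beta(N))_{N\ge0}$.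
   Context: Let $\varphi=(1+\sqrt5)/2$. Every natural number $N$ can be written uniquely (ignoring leading and trailing zeros) as a finite sum $N=\sum_{i=R}^{L}d_i\varphi^i$ with $i$ ranging over integers (possibly negative), digits $d_i\in\{0,1\}$, and no two consecutive digits $d_i,d_{i+1}$ both equal to $1$ (base phi expansion). The base phi sum of digits function $s_\beta(N)$ is the number of digits equal to $1$ in this expansion, with $s_\beta(0)=0$. The image of an infinite word under a morphism is the concatenation of the images of its letters. -}

module Defs where

open import Data.Digit using (Bit)
open import Data.Empty using (⊥-elim)
open import Data.Fin.Base using (toℕ; fromℕ<)
open import Data.Fin.Patterns using (0F; 1F)
open import Data.Integer.Base as ℤ using (ℤ; +_; -[1+_])
import Data.Integer.Properties as ℤ
open import Data.Integer.Tactic.RingSolver using (solve-∀)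
open import Data.List.Base
  using (List; []; _∷_; [_]; _++_; length; lookup; map; concatMap; applyUpTo; replicate)
open import Data.List.NonEmpty.Base using (List⁺; _∷_; toList)
open import Data.List.Properties using (concatMap-++; ++-assoc; ++-identityʳ)
open import Data.List.Relation.Unary.Linked as Linked using (Linked; []; [-]; _∷_)
open import Data.Nat.ListAction using (sum)
open import Data.Nat.Base as ℕ using (ℕ; zero; suc; _<_; _≤_; z≤n; s≤s; z<s)
import Data.Nat.Properties as ℕ
open import Data.Product.Base using (_×_; _,_; ∃; ∃₂)
open import Data.Sum.Base using (inj₁; inj₂)
open import Function.Base using (_∘_)
open import Relation.Binary.PropositionalEquality hiding ([_])
open import Relation.Nullary.Negation.Core using (¬_)

-- ⟨ a , b ⟩ stands for a + bφ.  As φ is irrational, two such numbers are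
-- equal in ℝ exactly when their coefficients agree, so propositional
-- equality on this record is equality of reals.

record ℤ[φ] : Set where
  no-eta-equality; pattern
  constructor ⟨_,_⟩
  field
    re im : ℤ

open ℤ[φ] public

infixl 6 _+_
infixl 7 _*_

_+_ : ℤ[φ] → ℤ[φ] → ℤ[φ]
⟨ a , b ⟩ + ⟨ c , d ⟩ = ⟨ a ℤ.+ c , b ℤ.+ d ⟩

-- Uses φ² = φ + 1.
_*_ : ℤ[φ] → ℤ[φ] → ℤ[φ]
⟨ a , b ⟩ * ⟨ c , d ⟩ =
  ⟨ a ℤ.* c ℤ.+ b ℤ.* d , a ℤ.* d ℤ.+ b ℤ.* c ℤ.+ b ℤ.* d ⟩

fromℕ : ℕ → ℤ[φ]
fromℕ n = ⟨ + n , + 0 ⟩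

φ φ⁻¹ : ℤ[φ]
φ   = ⟨ + 0 , + 1 ⟩
φ⁻¹ = ⟨ ℤ.-1ℤ , + 1 ⟩

φ*φ⁻¹≡1 : φ * φ⁻¹ ≡ fromℕ 1
φ*φ⁻¹≡1 = refl

φ^ : ℤ → ℤ[φ]
φ^ (+ zero)      = fromℕ 1
φ^ (+ suc n)     = φ * φ^ (+ n)
φ^ (-[1+ zero ]) = φ⁻¹
φ^ (-[1+ suc n ]) = φ⁻¹ * φ^ (-[1+ n ])

-- A digit string is written with its most significant digit first, as
-- d_L d_{L-1} … d_R; `value L` is the number Σ dᵢ φⁱ, where L is the
-- position of the leading digit.

value : ℤ → List Bit → ℤ[φ]
value L []       = fromℕ 0
value L (d ∷ ds) = fromℕ (toℕ d) * φ^ L + value (ℤ.pred L) ds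

NotBothOne : Bit → Bit → Set
NotBothOne d e = ¬ (d ≡ 1F × e ≡ 1F)

No11 : List Bit → Set
No11 = Linked NotBothOne

record BasePhiExpansion (N : ℕ) : Set where
  constructor expansion
  field
    top     : ℤ
    digits  : List Bit
    no11    : No11 digits
    value≡N : value top digits ≡ fromℕ N

open BasePhiExpansion public

digitSum : List Bit → ℕ
digitSum ds = sum (map toℕ ds)

+-identityˡ : ∀ x → fromℕ 0 + x ≡ x
+-identityˡ ⟨ a , b ⟩ = cong₂ ⟨_,_⟩ (ℤ.+-identityˡ a) (ℤ.+-identityˡ b)

+-identityʳ : ∀ x → x + fromℕ 0 ≡ x
+-identityʳ ⟨ a , b ⟩ = cong₂ ⟨_,_⟩ (ℤ.+-identityʳ a) (ℤ.+-identityʳ b)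

+-assoc : ∀ x y z → (x + y) + z ≡ x + (y + z)
+-assoc ⟨ a , b ⟩ ⟨ c , d ⟩ ⟨ e , f ⟩ = cong₂ ⟨_,_⟩ (ℤ.+-assoc a c e) (ℤ.+-assoc b d f)

+-comm : ∀ x y → x + y ≡ y + x
+-comm ⟨ a , b ⟩ ⟨ c , d ⟩ = cong₂ ⟨_,_⟩ (ℤ.+-comm a c) (ℤ.+-comm b d)

*-distribˡ-+ : ∀ x y z → x * (y + z) ≡ x * y + x * z
*-distribˡ-+ ⟨ a , b ⟩ ⟨ c , d ⟩ ⟨ e , f ⟩ = cong₂ ⟨_,_⟩ (p a b c d e f) (q a b c d e f)
  where
  p : ∀ a b c d e f → a ℤ.* (c ℤ.+ e) ℤ.+ b ℤ.* (d ℤ.+ f) ≡ (a ℤ.* c ℤ.+ b ℤ.* d) ℤ.+ (a ℤ.* e ℤ.+ b ℤ.* f)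
  p = solve-∀
  q : ∀ a b c d e f → a ℤ.* (d ℤ.+ f) ℤ.+ b ℤ.* (c ℤ.+ e) ℤ.+ b ℤ.* (d ℤ.+ f)
                    ≡ (a ℤ.* d ℤ.+ b ℤ.* c ℤ.+ b ℤ.* d) ℤ.+ (a ℤ.* f ℤ.+ b ℤ.* e ℤ.+ b ℤ.* f)
  q = solve-∀

*-swap : ∀ x y z → x * (y * z) ≡ y * (x * z)
*-swap ⟨ a , b ⟩ ⟨ c , d ⟩ ⟨ e , f ⟩ = cong₂ ⟨_,_⟩ (p a b c d e f) (q a b c d e f)
  where
  p : ∀ a b c d e f → a ℤ.* (c ℤ.* e ℤ.+ d ℤ.* f) ℤ.+ b ℤ.* (c ℤ.* f ℤ.+ d ℤ.* e ℤ.+ d ℤ.* f)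
                    ≡ c ℤ.* (a ℤ.* e ℤ.+ b ℤ.* f) ℤ.+ d ℤ.* (a ℤ.* f ℤ.+ b ℤ.* e ℤ.+ b ℤ.* f)
  p = solve-∀
  q : ∀ a b c d e f
    → a ℤ.* (c ℤ.* f ℤ.+ d ℤ.* e ℤ.+ d ℤ.* f) ℤ.+ b ℤ.* (c ℤ.* e ℤ.+ d ℤ.* f) ℤ.+ b ℤ.* (c ℤ.* f ℤ.+ d ℤ.* e ℤ.+ d ℤ.* f)
    ≡ c ℤ.* (a ℤ.* f ℤ.+ b ℤ.* e ℤ.+ b ℤ.* f) ℤ.+ d ℤ.* (a ℤ.* e ℤ.+ b ℤ.* f) ℤ.+ d ℤ.* (a ℤ.* f ℤ.+ b ℤ.* e ℤ.+ b ℤ.* f)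
  q = solve-∀

*-zeroˡ : ∀ x → fromℕ 0 * x ≡ fromℕ 0
*-zeroˡ ⟨ a , b ⟩ = refl

*-zeroʳ : ∀ x → x * fromℕ 0 ≡ fromℕ 0
*-zeroʳ ⟨ a , b ⟩ = cong₂ ⟨_,_⟩ (p a b) (q a b)
  where
  p : ∀ a b → a ℤ.* + 0 ℤ.+ b ℤ.* + 0 ≡ + 0
  p = solve-∀
  q : ∀ a b → a ℤ.* + 0 ℤ.+ b ℤ.* + 0 ℤ.+ b ℤ.* + 0 ≡ + 0
  q = solve-∀

*-identityˡ : ∀ x → fromℕ 1 * x ≡ x
*-identityˡ ⟨ a , b ⟩ = cong₂ ⟨_,_⟩ (p a b) (q a b)
  where
  p : ∀ a b → + 1 ℤ.* a ℤ.+ + 0 ℤ.* b ≡ a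
  p = solve-∀
  q : ∀ a b → + 1 ℤ.* b ℤ.+ + 0 ℤ.* a ℤ.+ + 0 ℤ.* b ≡ b
  q = solve-∀

φ* : ∀ x → φ * x ≡ ⟨ im x , re x ℤ.+ im x ⟩
φ* ⟨ a , b ⟩ = cong₂ ⟨_,_⟩ (p a b) (q a b)
  where
  p : ∀ a b → + 0 ℤ.* a ℤ.+ + 1 ℤ.* b ≡ b
  p = solve-∀
  q : ∀ a b → + 0 ℤ.* b ℤ.+ + 1 ℤ.* a ℤ.+ + 1 ℤ.* b ≡ a ℤ.+ b
  q = solve-∀

φ⁻¹* : ∀ x → φ⁻¹ * x ≡ ⟨ im x ℤ.- re x , re x ⟩
φ⁻¹* ⟨ a , b ⟩ = cong₂ ⟨_,_⟩ (p a b) (q a b)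
  where
  p : ∀ a b → ℤ.-1ℤ ℤ.* a ℤ.+ + 1 ℤ.* b ≡ b ℤ.- a
  p = solve-∀
  q : ∀ a b → ℤ.-1ℤ ℤ.* b ℤ.+ + 1 ℤ.* a ℤ.+ + 1 ℤ.* b ≡ a
  q = solve-∀

φ*φ⁻¹* : ∀ x → φ * (φ⁻¹ * x) ≡ x
φ*φ⁻¹* x@(⟨ a , b ⟩) =
  trans (cong (φ *_) (φ⁻¹* x)) (trans (φ* ⟨ b ℤ.- a , a ⟩) (cong ⟨ a ,_⟩ (p a b)))
  where
  p : ∀ a b → (b ℤ.- a) ℤ.+ a ≡ b
  p = solve-∀

φ*≡+φ⁻¹* : ∀ x → φ * x ≡ x + φ⁻¹ * x
φ*≡+φ⁻¹* x@(⟨ a , b ⟩) =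
  trans (φ* x) (trans (cong₂ ⟨_,_⟩ (p a b) (ℤ.+-comm a b)) (cong (_+_ x) (sym (φ⁻¹* x))))
  where
  p : ∀ a b → b ≡ a ℤ.+ (b ℤ.- a)
  p = solve-∀

φ⁻¹*φ* : ∀ x → φ⁻¹ * (φ * x) ≡ x
φ⁻¹*φ* x = trans (*-swap φ⁻¹ φ x) (φ*φ⁻¹* x)

φ^-suc : ∀ i → φ^ (ℤ.suc i) ≡ φ * φ^ i
φ^-suc (+ n)          = refl
φ^-suc -[1+ zero ]    = refl
φ^-suc -[1+ suc n ]   = sym (φ*φ⁻¹* (φ^ -[1+ n ]))

φ^-pred : ∀ i → φ^ (ℤ.pred i) ≡ φ⁻¹ * φ^ i
φ^-pred i = begin
  φ^ (ℤ.pred i)                   ≡⟨ φ⁻¹*φ* _ ⟨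
  φ⁻¹ * (φ * φ^ (ℤ.pred i))       ≡⟨ cong (φ⁻¹ *_) (φ^-suc (ℤ.pred i)) ⟨
  φ⁻¹ * φ^ (ℤ.suc (ℤ.pred i))     ≡⟨ cong (λ j → φ⁻¹ * φ^ j) (ℤ.suc-pred i) ⟩
  φ⁻¹ * φ^ i                      ∎
  where open ≡-Reasoning

φ^-fib : ∀ i → φ^ (ℤ.suc i) ≡ φ^ i + φ^ (ℤ.pred i)
φ^-fib i = begin
  φ^ (ℤ.suc i)           ≡⟨ φ^-suc i ⟩
  φ * φ^ i               ≡⟨ φ*≡+φ⁻¹* (φ^ i) ⟩
  φ^ i + φ⁻¹ * φ^ i      ≡⟨ cong (_+_ (φ^ i)) (φ^-pred i) ⟨
  φ^ i + φ^ (ℤ.pred i)   ∎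
  where open ≡-Reasoning

value-0∷ : ∀ i w → value i (0F ∷ w) ≡ value (ℤ.pred i) w
value-0∷ i w = trans (cong (_+ value (ℤ.pred i) w) (*-zeroˡ (φ^ i))) (+-identityˡ _)

value-1∷ : ∀ i w → value i (1F ∷ w) ≡ φ^ i + value (ℤ.pred i) w
value-1∷ i w = cong (_+ value (ℤ.pred i) w) (*-identityˡ (φ^ i))

value-suc-0∷ : ∀ i w → value (ℤ.suc i) (0F ∷ w) ≡ value i w
value-suc-0∷ i w = trans (value-0∷ (ℤ.suc i) w) (cong (λ j → value j w) (ℤ.pred-suc i))

value-suc-1∷ : ∀ i w → value (ℤ.suc i) (1F ∷ w) ≡ φ^ (ℤ.suc i) + value i w
value-suc-1∷ i w =
  trans (value-1∷ (ℤ.suc i) w) (cong (λ j → φ^ (ℤ.suc i) + value j w) (ℤ.pred-suc i))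

value-suc : ∀ i w → value (ℤ.suc i) w ≡ φ * value i w
value-suc i []       = sym (*-zeroʳ φ)
value-suc i (d ∷ w) = begin
  x * φ^ (ℤ.suc i) + value (ℤ.pred (ℤ.suc i)) w
    ≡⟨ cong₂ (λ y j → x * y + value j w) (φ^-suc i)
         (trans (ℤ.pred-suc i) (sym (ℤ.suc-pred i))) ⟩
  x * (φ * φ^ i) + value (ℤ.suc (ℤ.pred i)) w
    ≡⟨ cong₂ _+_ (*-swap x φ (φ^ i)) (value-suc (ℤ.pred i) w) ⟩
  φ * (x * φ^ i) + φ * value (ℤ.pred i) w
    ≡⟨ *-distribˡ-+ φ _ _ ⟨
  φ * value i (d ∷ w) ∎
  where
  open ≡-Reasoning
  x = fromℕ (toℕ d)

1-1 : ∀ {w} → ¬ No11 (1F ∷ 1F ∷ w)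
1-1 (p ∷ _) = p (refl , refl)

0-ok : ∀ {w} → No11 w → No11 (0F ∷ w)
0-ok []          = [-]
0-ok [-]         = (λ ()) ∷ [-]
0-ok (p ∷ l)     = (λ ()) ∷ p ∷ l

10-ok : ∀ {w} → No11 (0F ∷ w) → No11 (1F ∷ 0F ∷ w)
10-ok l = (λ ()) ∷ l

-- Adds φⁱ to a string whose leading position is i; the leading position
-- of the result is i + 1.  Carries go by φⁱ + φⁱ⁻¹ = φⁱ⁺¹ and
-- 2φⁱ = φⁱ⁺¹ + φⁱ⁻².

addTop : List Bit → List Bit
addTop []               = 0F ∷ 1F ∷ []
addTop (0F ∷ [])        = 0F ∷ 1F ∷ []
addTop (0F ∷ 0F ∷ w)    = 0F ∷ 1F ∷ 0F ∷ w
addTop (0F ∷ 1F ∷ w)    = 1F ∷ 0F ∷ 0F ∷ w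
addTop (1F ∷ [])        = 1F ∷ 0F ∷ 0F ∷ 1F ∷ []
addTop (1F ∷ _ ∷ w)     = 1F ∷ 0F ∷ addTop w

-- Adds 1 to a string whose leading position is n ≥ 0; the leading
-- position of the result is n + 1.

insert10 : List Bit → List Bit
insert10 (1F ∷ w) = 1F ∷ 0F ∷ 0F ∷ w
insert10 w        = 0F ∷ 1F ∷ w

addOne : ℕ → List Bit → List Bit
addOne zero          w              = addTop w
addOne (suc n)       []             = 0F ∷ addOne n []
addOne (suc n)       (0F ∷ w)       = 0F ∷ addOne n w
addOne (suc zero)    (1F ∷ [])      = 1F ∷ 0F ∷ 0F ∷ []
addOne (suc zero)    (1F ∷ _ ∷ w)   = 1F ∷ 0F ∷ 0F ∷ w
addOne (suc (suc n)) (1F ∷ [])      = insert10 (addOne n [])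
addOne (suc (suc n)) (1F ∷ _ ∷ w)   = insert10 (addOne n w)

addTop-no11 : ∀ w → No11 w → No11 (addTop w)
addTop-no11 []            l = (λ ()) ∷ [-]
addTop-no11 (0F ∷ [])     l = (λ ()) ∷ [-]
addTop-no11 (0F ∷ 0F ∷ w) l = (λ ()) ∷ 10-ok (Linked.tail l)
addTop-no11 (0F ∷ 1F ∷ w) l = 10-ok (0-ok (0-ok (Linked.tail (Linked.tail l))))
addTop-no11 (1F ∷ [])     l = 10-ok (0-ok (0-ok [-]))
addTop-no11 (1F ∷ 0F ∷ w) l = 10-ok (0-ok (addTop-no11 w (Linked.tail (Linked.tail l))))
addTop-no11 (1F ∷ 1F ∷ w) l = ⊥-elim (1-1 l)

insert10-no11 : ∀ w → No11 w → No11 (insert10 w)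
insert10-no11 []            l = (λ ()) ∷ [-]
insert10-no11 (0F ∷ w)      l = (λ ()) ∷ 10-ok l
insert10-no11 (1F ∷ w)      l = 10-ok (0-ok (0-ok (Linked.tail l)))

addOne-no11 : ∀ n w → No11 w → No11 (addOne n w)
addOne-no11 zero          w             l = addTop-no11 w l
addOne-no11 (suc n)       []            l = 0-ok (addOne-no11 n [] [])
addOne-no11 (suc n)       (0F ∷ w)      l = 0-ok (addOne-no11 n w (Linked.tail l))
addOne-no11 (suc zero)    (1F ∷ [])     l = 10-ok (0-ok [-])
addOne-no11 (suc zero)    (1F ∷ 0F ∷ w) l = 10-ok (0-ok (Linked.tail l))
addOne-no11 (suc zero)    (1F ∷ 1F ∷ w) l = ⊥-elim (1-1 l)
addOne-no11 (suc (suc n)) (1F ∷ [])     l = insert10-no11 _ (addOne-no11 n [] [])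
addOne-no11 (suc (suc n)) (1F ∷ 0F ∷ w) l =
  insert10-no11 _ (addOne-no11 n w (Linked.tail (Linked.tail l)))
addOne-no11 (suc (suc n)) (1F ∷ 1F ∷ w) l = ⊥-elim (1-1 l)

value-1∷[] : ∀ i → value i (1F ∷ []) ≡ φ^ i
value-1∷[] i = trans (value-1∷ i []) (+-identityʳ _)

value-10∷ : ∀ i w → value (ℤ.suc i) (1F ∷ 0F ∷ w) ≡ φ^ (ℤ.suc i) + value (ℤ.pred i) w
value-10∷ i w = trans (value-suc-1∷ i (0F ∷ w)) (cong (_+_ (φ^ (ℤ.suc i))) (value-0∷ i w))

twice : ∀ i → φ^ (ℤ.suc i) + φ^ (ℤ.pred (ℤ.pred i)) ≡ φ^ i + φ^ i
twice i = begin
  φ^ (ℤ.suc i) + z     ≡⟨ cong (_+ z) (φ^-fib i) ⟩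
  (φ^ i + y) + z       ≡⟨ +-assoc (φ^ i) y z ⟩
  φ^ i + (y + z)       ≡⟨ cong (_+_ (φ^ i)) (φ^-fib (ℤ.pred i)) ⟨
  φ^ i + φ^ (ℤ.suc (ℤ.pred i))  ≡⟨ cong (λ j → φ^ i + φ^ j) (ℤ.suc-pred i) ⟩
  φ^ i + φ^ i          ∎
  where
  open ≡-Reasoning
  y = φ^ (ℤ.pred i)
  z = φ^ (ℤ.pred (ℤ.pred i))

addTop-value : ∀ i w → No11 w → value (ℤ.suc i) (addTop w) ≡ φ^ i + value i w
addTop-value i []        l =
  trans (value-suc-0∷ i (1F ∷ [])) (value-1∷ i [])
addTop-value i (0F ∷ []) l =
  trans (value-suc-0∷ i (1F ∷ [])) (trans (value-1∷ i []) (cong (_+_ (φ^ i)) (sym (value-0∷ i []))))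
addTop-value i (0F ∷ 0F ∷ w) l =
  trans (value-suc-0∷ i (1F ∷ 0F ∷ w)) (trans (value-1∷ i (0F ∷ w)) (cong (_+_ (φ^ i)) (sym (value-0∷ i (0F ∷ w)))))
addTop-value i (0F ∷ 1F ∷ w) l = begin
  value (ℤ.suc i) (1F ∷ 0F ∷ 0F ∷ w)  ≡⟨ value-10∷ i (0F ∷ w) ⟩
  φ^ (ℤ.suc i) + value i′ (0F ∷ w)    ≡⟨ cong₂ _+_ (φ^-fib i) (value-0∷ i′ w) ⟩
  (φ^ i + φ^ i′) + value (ℤ.pred i′) w ≡⟨ +-assoc (φ^ i) (φ^ i′) _ ⟩
  φ^ i + (φ^ i′ + value (ℤ.pred i′) w) ≡⟨ cong (_+_ (φ^ i)) (value-1∷ i′ w) ⟨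
  φ^ i + value i′ (1F ∷ w)             ≡⟨ cong (_+_ (φ^ i)) (value-0∷ i (1F ∷ w)) ⟨
  φ^ i + value i (0F ∷ 1F ∷ w)         ∎
  where
  open ≡-Reasoning
  i′ = ℤ.pred i
addTop-value i (1F ∷ []) l = begin
  value (ℤ.suc i) (1F ∷ 0F ∷ 0F ∷ 1F ∷ []) ≡⟨ value-10∷ i (0F ∷ 1F ∷ []) ⟩
  φ^ (ℤ.suc i) + value i′ (0F ∷ 1F ∷ [])
    ≡⟨ cong (_+_ (φ^ (ℤ.suc i))) (trans (value-0∷ i′ (1F ∷ [])) (value-1∷[] (ℤ.pred i′))) ⟩
  φ^ (ℤ.suc i) + φ^ (ℤ.pred i′)            ≡⟨ twice i ⟩
  φ^ i + φ^ i                              ≡⟨ cong (_+_ (φ^ i)) (value-1∷[] i) ⟨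
  φ^ i + value i (1F ∷ [])                 ∎
  where
  open ≡-Reasoning
  i′ = ℤ.pred i
addTop-value i (1F ∷ 0F ∷ w) l = begin
  value (ℤ.suc i) (1F ∷ 0F ∷ addTop w)     ≡⟨ value-10∷ i (addTop w) ⟩
  φ^ (ℤ.suc i) + value i′ (addTop w)
    ≡⟨ cong (λ j → φ^ (ℤ.suc i) + value j (addTop w)) (ℤ.suc-pred i′) ⟨
  φ^ (ℤ.suc i) + value (ℤ.suc i″) (addTop w)
    ≡⟨ cong (_+_ (φ^ (ℤ.suc i))) (addTop-value i″ w (Linked.tail (Linked.tail l))) ⟩
  φ^ (ℤ.suc i) + (φ^ i″ + value i″ w)      ≡⟨ +-assoc (φ^ (ℤ.suc i)) (φ^ i″) _ ⟨
  (φ^ (ℤ.suc i) + φ^ i″) + value i″ w      ≡⟨ cong (_+ value i″ w) (twice i) ⟩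
  (φ^ i + φ^ i) + value i″ w               ≡⟨ +-assoc (φ^ i) (φ^ i) _ ⟩
  φ^ i + (φ^ i + value i″ w)
    ≡⟨ cong (λ v → φ^ i + (φ^ i + v)) (value-0∷ i′ w) ⟨
  φ^ i + (φ^ i + value i′ (0F ∷ w))        ≡⟨ cong (_+_ (φ^ i)) (value-1∷ i (0F ∷ w)) ⟨
  φ^ i + value i (1F ∷ 0F ∷ w)             ∎
  where
  open ≡-Reasoning
  i′ = ℤ.pred i
  i″ = ℤ.pred i′
addTop-value i (1F ∷ 1F ∷ w) l = ⊥-elim (1-1 l)

insert10-value : ∀ i w →
  value (ℤ.suc (ℤ.suc i)) (insert10 w) ≡ φ^ (ℤ.suc i) + value i w
insert10-value i []       = trans (value-suc-0∷ (ℤ.suc i) (1F ∷ [])) (value-suc-1∷ i [])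
insert10-value i (0F ∷ w) = trans (value-suc-0∷ (ℤ.suc i) (1F ∷ 0F ∷ w)) (value-suc-1∷ i (0F ∷ w))
insert10-value i (1F ∷ w) = begin
  value (ℤ.suc j) (1F ∷ 0F ∷ 0F ∷ w)
    ≡⟨ value-10∷ j (0F ∷ w) ⟩
  φ^ (ℤ.suc j) + value (ℤ.pred j) (0F ∷ w)
    ≡⟨ cong (λ k → φ^ (ℤ.suc j) + value k (0F ∷ w)) (ℤ.pred-suc i) ⟩
  φ^ (ℤ.suc j) + value i (0F ∷ w)
    ≡⟨ cong₂ _+_ (φ^-fib j) (value-0∷ i w) ⟩
  (φ^ j + φ^ (ℤ.pred j)) + value (ℤ.pred i) w
    ≡⟨ cong (λ k → (φ^ j + φ^ k) + value (ℤ.pred i) w) (ℤ.pred-suc i) ⟩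
  (φ^ j + φ^ i) + value (ℤ.pred i) w  ≡⟨ +-assoc (φ^ j) (φ^ i) _ ⟩
  φ^ j + (φ^ i + value (ℤ.pred i) w)  ≡⟨ cong (_+_ (φ^ j)) (value-1∷ i w) ⟨
  φ^ j + value i (1F ∷ w)             ∎
  where
  open ≡-Reasoning
  j = ℤ.suc i

left-comm : ∀ x y z → x + (y + z) ≡ y + (x + z)
left-comm x y z = trans (sym (+-assoc x y z)) (trans (cong (_+ z) (+-comm x y)) (+-assoc y x z))

addOne-value : ∀ n w → No11 w → value (+ suc n) (addOne n w) ≡ fromℕ 1 + value (+ n) w
addOne-value zero    w        l = addTop-value (+ 0) w l
addOne-value (suc n) []       l = trans (value-suc-0∷ (+ suc n) (addOne n [])) (addOne-value n [] [])
addOne-value (suc n) (0F ∷ w) l =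
  trans (value-suc-0∷ (+ suc n) (addOne n w))
    (trans (addOne-value n w (Linked.tail l)) (cong (_+_ (fromℕ 1)) (sym (value-suc-0∷ (+ n) w))))
addOne-value (suc zero) (1F ∷ []) l = refl
addOne-value (suc zero) (1F ∷ 0F ∷ w) l = begin
  value (+ 2) (1F ∷ 0F ∷ 0F ∷ w)        ≡⟨ value-10∷ (+ 1) (0F ∷ w) ⟩
  φ^ (+ 2) + value (+ 0) (0F ∷ w)       ≡⟨⟩
  (fromℕ 1 + φ^ (+ 1)) + value (+ 0) (0F ∷ w) ≡⟨ +-assoc (fromℕ 1) (φ^ (+ 1)) _ ⟩
  fromℕ 1 + (φ^ (+ 1) + value (+ 0) (0F ∷ w)) ≡⟨ cong (_+_ (fromℕ 1)) (value-1∷ (+ 1) (0F ∷ w)) ⟨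
  fromℕ 1 + value (+ 1) (1F ∷ 0F ∷ w)   ∎
  where open ≡-Reasoning
addOne-value (suc zero) (1F ∷ 1F ∷ w) l = ⊥-elim (1-1 l)
addOne-value (suc (suc n)) (1F ∷ []) l = begin
  value (+ suc (suc (suc n))) (insert10 (addOne n []))
    ≡⟨ insert10-value (+ suc n) (addOne n []) ⟩
  φ^ (+ suc (suc n)) + value (+ suc n) (addOne n [])
    ≡⟨ cong (_+_ (φ^ (+ suc (suc n)))) (addOne-value n [] []) ⟩
  φ^ (+ suc (suc n)) + fromℕ 1
    ≡⟨ +-comm (φ^ (+ suc (suc n))) (fromℕ 1) ⟩
  fromℕ 1 + φ^ (+ suc (suc n))
    ≡⟨ cong (_+_ (fromℕ 1)) (value-1∷[] (+ suc (suc n))) ⟨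
  fromℕ 1 + value (+ suc (suc n)) (1F ∷ []) ∎
  where open ≡-Reasoning
addOne-value (suc (suc n)) (1F ∷ 0F ∷ w) l = begin
  value (+ suc (suc (suc n))) (insert10 (addOne n w))
    ≡⟨ insert10-value (+ suc n) (addOne n w) ⟩
  φ^ (+ suc (suc n)) + value (+ suc n) (addOne n w)
    ≡⟨ cong (_+_ (φ^ (+ suc (suc n)))) (addOne-value n w (Linked.tail (Linked.tail l))) ⟩
  φ^ (+ suc (suc n)) + (fromℕ 1 + value (+ n) w)
    ≡⟨ left-comm (φ^ (+ suc (suc n))) (fromℕ 1) _ ⟩
  fromℕ 1 + (φ^ (+ suc (suc n)) + value (+ n) w)
    ≡⟨ cong (_+_ (fromℕ 1)) (value-10∷ (+ suc n) w) ⟨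
  fromℕ 1 + value (+ suc (suc n)) (1F ∷ 0F ∷ w) ∎
  where open ≡-Reasoning
addOne-value (suc (suc n)) (1F ∷ 1F ∷ w) l = ⊥-elim (1-1 l)

-- The expansion of N produced here has N as its leading position, so it
-- generally starts with zeros.

expansionDigits : ℕ → List Bit
expansionDigits zero    = []
expansionDigits (suc N) = addOne N (expansionDigits N)

expansion-no11 : ∀ N → No11 (expansionDigits N)
expansion-no11 zero    = []
expansion-no11 (suc N) = addOne-no11 N _ (expansion-no11 N)

expansion-value : ∀ N → value (+ N) (expansionDigits N) ≡ fromℕ N
expansion-value zero    = refl
expansion-value (suc N) =
  trans (addOne-value N _ (expansion-no11 N)) (cong (_+_ (fromℕ 1)) (expansion-value N))

basePhiExpansion : ∀ N → BasePhiExpansion N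
basePhiExpansion N = expansion (+ N) (expansionDigits N) (expansion-no11 N) (expansion-value N)

sβ : ℕ → ℕ
sβ N = digitSum (digits (basePhiExpansion N))

fib : ℕ → ℕ
fib zero          = 0
fib (suc zero)    = 1
fib (suc (suc n)) = fib n ℕ.+ fib (suc n)

φ^-fib-coeffs : ∀ n → φ^ (+ suc n) ≡ ⟨ + fib n , + fib (suc n) ⟩
φ^-fib-coeffs zero    = refl
φ^-fib-coeffs (suc n) = trans (cong (φ *_) (φ^-fib-coeffs n)) (φ* ⟨ + fib n , + fib (suc n) ⟩)

-- Reads a string of at most n digits with Fibonacci weights, the
-- leading weight being fib (n + 1).

zeck : ℕ → List Bit → ℕ
zeck n       []       = 0
zeck zero    (_ ∷ _)  = 0
zeck (suc n) (0F ∷ w) = zeck n w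
zeck (suc n) (1F ∷ w) = fib (suc (suc n)) ℕ.+ zeck n w

im-+ : ∀ x y → im (x + y) ≡ im x ℤ.+ im y
im-+ ⟨ _ , _ ⟩ ⟨ _ , _ ⟩ = refl

im-value : ∀ n w → length w ≤ n → im (value (+ suc n) w) ≡ + zeck n w
im-value n       []       _         = refl
im-value (suc n) (0F ∷ w) (s≤s w≤n) =
  trans (cong im (value-0∷ (+ suc (suc n)) w)) (im-value n w w≤n)
im-value (suc n) (1F ∷ w) (s≤s w≤n) =
  trans (cong im (value-1∷ (+ suc (suc n)) w))
    (trans (im-+ (φ^ (+ suc (suc n))) (value (+ suc n) w))
      (cong₂ ℤ._+_ (cong im (φ^-fib-coeffs (suc n))) (im-value n w w≤n)))

fib-pos : ∀ n → 0 < fib (suc n)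
fib-pos zero    = z<s
fib-pos (suc n) = ℕ.≤-trans (fib-pos n) (ℕ.m≤n+m _ (fib n))

zeck-bound : ∀ n w → No11 w → zeck n w < fib (suc (suc n))
zeck-bound n       []        _ = fib-pos (suc n)
zeck-bound zero    (_ ∷ _)   _ = z<s
zeck-bound (suc n) (0F ∷ w)  l =
  ℕ.≤-trans (zeck-bound n w (Linked.tail l)) (ℕ.m≤n+m _ (fib (suc n)))
zeck-bound (suc n) (1F ∷ [])       _ =
  subst (fib (suc (suc n)) ℕ.+ 0 <_) (ℕ.+-comm (fib (suc (suc n))) (fib (suc n)))
    (ℕ.+-monoʳ-< (fib (suc (suc n))) (fib-pos n))
zeck-bound (suc zero) (1F ∷ 0F ∷ w) _ = s≤s (s≤s z≤n)
zeck-bound (suc (suc n)) (1F ∷ 0F ∷ w) l =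
  subst (fib (3 ℕ.+ n) ℕ.+ zeck n w <_) (ℕ.+-comm (fib (3 ℕ.+ n)) (fib (suc (suc n))))
    (ℕ.+-monoʳ-< (fib (3 ℕ.+ n)) (zeck-bound n w (Linked.tail (Linked.tail l))))
zeck-bound (suc n) (1F ∷ 1F ∷ w) l = ⊥-elim (1-1 l)

zeck-1≢0 : ∀ n w v → No11 v → zeck (suc n) (1F ∷ w) ≢ zeck n v
zeck-1≢0 n w v l eq =
  ℕ.<⇒≱ (zeck-bound n v l) (ℕ.≤-trans (ℕ.m≤m+n _ (zeck n w)) (ℕ.≤-reflexive eq))

zeck-unique : ∀ n w v → length w ≤ n → length v ≤ n → No11 w → No11 v →
              zeck n w ≡ zeck n v → digitSum w ≡ digitSum v
zeck-unique n [] [] _ _ _ _ _ = refl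
zeck-unique (suc n) [] (0F ∷ v) _ (s≤s q) _ m eq = zeck-unique n [] v z≤n q [] (Linked.tail m) eq
zeck-unique (suc n) [] (1F ∷ v) _ _ _ _ eq = ⊥-elim (zeck-1≢0 n v [] [] (sym eq))
zeck-unique (suc n) (0F ∷ w) [] (s≤s p) _ l _ eq = zeck-unique n w [] p z≤n (Linked.tail l) [] eq
zeck-unique (suc n) (1F ∷ w) [] _ _ _ _ eq = ⊥-elim (zeck-1≢0 n w [] [] eq)
zeck-unique (suc n) (0F ∷ w) (0F ∷ v) (s≤s p) (s≤s q) l m eq =
  zeck-unique n w v p q (Linked.tail l) (Linked.tail m) eq
zeck-unique (suc n) (0F ∷ w) (1F ∷ v) _ _ l _ eq =
  ⊥-elim (zeck-1≢0 n v w (Linked.tail l) (sym eq))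
zeck-unique (suc n) (1F ∷ w) (0F ∷ v) _ _ _ m eq =
  ⊥-elim (zeck-1≢0 n w v (Linked.tail m) eq)
zeck-unique (suc n) (1F ∷ w) (1F ∷ v) (s≤s p) (s≤s q) l m eq =
  cong suc (zeck-unique n w v p q (Linked.tail l) (Linked.tail m)
    (ℕ.+-cancelˡ-≡ (fib (suc (suc n))) _ _ eq))

value-shift : ∀ k n w v → value (+ n) w ≡ value (+ n) v →
              value (+ (k ℕ.+ n)) w ≡ value (+ (k ℕ.+ n)) v
value-shift zero    n w v eq = eq
value-shift (suc k) n w v eq = begin
  value (+ suc (k ℕ.+ n)) w   ≡⟨ value-suc (+ (k ℕ.+ n)) w ⟩
  φ * value (+ (k ℕ.+ n)) w   ≡⟨ cong (φ *_) (value-shift k n w v eq) ⟩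
  φ * value (+ (k ℕ.+ n)) v   ≡⟨ value-suc (+ (k ℕ.+ n)) v ⟨
  value (+ suc (k ℕ.+ n)) v   ∎
  where open ≡-Reasoning

digitSum-unique-aligned : ∀ n w v → No11 w → No11 v →
  value (+ n) w ≡ value (+ n) v → digitSum w ≡ digitSum v
digitSum-unique-aligned n w v l m eq =
  zeck-unique K w v w≤K v≤K l m (ℤ.+-injective (begin
    + zeck K w               ≡⟨ im-value K w w≤K ⟨
    im (value (+ suc K) w)   ≡⟨ cong im (value-shift (suc k) n w v eq) ⟩
    im (value (+ suc K) v)   ≡⟨ im-value K v v≤K ⟩
    + zeck K v               ∎))
  where
  open ≡-Reasoning
  k = length w ℕ.+ length v
  K = k ℕ.+ n
  w≤K : length w ≤ K
  w≤K = ℕ.≤-trans (ℕ.m≤m+n (length w) (length v)) (ℕ.m≤m+n k n)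
  v≤K : length v ≤ K
  v≤K = ℕ.≤-trans (ℕ.m≤n+m (length v) (length w)) (ℕ.m≤m+n k n)

pad : ℕ → List Bit → List Bit
pad k w = replicate k 0F ++ w

pad-no11 : ∀ k w → No11 w → No11 (pad k w)
pad-no11 zero    w l = l
pad-no11 (suc k) w l = 0-ok (pad-no11 k w l)

pad-value : ∀ k n w → value (+ (k ℕ.+ n)) (pad k w) ≡ value (+ n) w
pad-value zero    n w = refl
pad-value (suc k) n w = trans (value-suc-0∷ (+ (k ℕ.+ n)) (pad k w)) (pad-value k n w)

pad-digitSum : ∀ k w → digitSum (pad k w) ≡ digitSum w
pad-digitSum zero    w = refl
pad-digitSum (suc k) w = pad-digitSum k w

raise : ∀ L w → No11 w →
  ∃₂ λ n v → No11 v × value (+ n) v ≡ value L w × digitSum v ≡ digitSum w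
raise (+ n)         w l = n , w , l , refl , refl
raise -[1+ zero ]   w l = 0 , 0F ∷ w , 0-ok l , value-suc-0∷ -[1+ 0 ] w , refl
raise -[1+ suc k ]  w l with raise -[1+ k ] (0F ∷ w) (0-ok l)
... | n , v , m , eq , s = n , v , m , trans eq (value-suc-0∷ -[1+ suc k ] w) , s

digitSum-unique : ∀ {N} (e e′ : BasePhiExpansion N) →
                  digitSum (digits e) ≡ digitSum (digits e′)
digitSum-unique (expansion L w l p) (expansion L′ w′ l′ p′)
  with raise L w l | raise L′ w′ l′
... | n , v , m , eq , s | n′ , v′ , m′ , eq′ , s′ = begin
  digitSum w            ≡⟨ s ⟨
  digitSum v            ≡⟨ pad-digitSum n′ v ⟨
  digitSum (pad n′ v)   ≡⟨ digitSum-unique-aligned (n′ ℕ.+ n) _ _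
                             (pad-no11 n′ v m) (pad-no11 n v′ m′) aligned ⟩
  digitSum (pad n v′)   ≡⟨ pad-digitSum n v′ ⟩
  digitSum v′           ≡⟨ s′ ⟩
  digitSum w′           ∎
  where
  open ≡-Reasoning
  aligned : value (+ (n′ ℕ.+ n)) (pad n′ v) ≡ value (+ (n′ ℕ.+ n)) (pad n v′)
  aligned = begin
    value (+ (n′ ℕ.+ n)) (pad n′ v)  ≡⟨ pad-value n′ n v ⟩
    value (+ n) v                    ≡⟨ trans eq p ⟩
    fromℕ _                          ≡⟨ trans eq′ p′ ⟨
    value (+ n′) v′                  ≡⟨ pad-value n n′ v′ ⟨
    value (+ (n ℕ.+ n′)) (pad n v′)  ≡⟨ cong (λ t → value (+ t) (pad n v′)) (ℕ.+-comm n n′) ⟩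
    value (+ (n′ ℕ.+ n)) (pad n v′)  ∎

-- The value of sβ does not depend on the expansion chosen above.
sβ-unique : ∀ N (e : BasePhiExpansion N) → sβ N ≡ digitSum (digits e)
sβ-unique N e = digitSum-unique (basePhiExpansion N) e

-- All morphisms considered are nonerasing, hence List⁺.

Morphism : Set → Set → Set
Morphism A B = A → List⁺ B

InfiniteWord : Set → Set
InfiniteWord A = ℕ → A

module _ {A B : Set} where

  image : Morphism A B → List A → List B
  image f = concatMap (toList ∘ f)

  -- The infinite word u f(x₀) f(x₁) f(x₂) ….
  prependImage : List B → Morphism A B → InfiniteWord A → InfiniteWord B
  prependImage (b ∷ u) f x zero    = b
  prependImage (b ∷ u) f x (suc n) = prependImage u f x n
  prependImage []      f x zero    = List⁺.head (f (x 0))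
  prependImage []      f x (suc n) = prependImage (List⁺.tail (f (x 0))) f (x ∘ suc) n

  imageω : Morphism A B → InfiniteWord A → InfiniteWord B
  imageω = prependImage []

iterateMorphism : {A : Set} → Morphism A A → ℕ → A → List A
iterateMorphism f zero    a = [ a ]
iterateMorphism f (suc n) a = image f (iterateMorphism f n a)

-- x is the limit of the words w n: these are prefixes of x of unbounded
-- length.
record IsLimit {A : Set} (w : ℕ → List A) (x : InfiniteWord A) : Set where
  field
    prefix    : ∀ n → w n ≡ applyUpTo x (length (w n))
    unbounded : ∀ k → ∃ λ n → k < length (w n)

data Colour : Set where
  c₀ c₁ c₂ c₃ : Colour

Letter : Set
Letter = ℕ × Colour

γ : Morphism Letter Letter
γ (j , c₀) = (j , c₀) ∷ (j , c₁) ∷ []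
γ (j , c₁) = (j , c₂) ∷ (j , c₃) ∷ []
γ (j , c₂) = (j ℕ.+ 2 , c₀) ∷ (j ℕ.+ 2 , c₁) ∷ (j ℕ.+ 2 , c₂) ∷ []
γ (j , c₃) = (j ℕ.+ 1 , c₃) ∷ (j ℕ.+ 2 , c₂) ∷ (j ℕ.+ 1 , c₃) ∷ []

δ : Morphism Letter ℕ
δ (j , c₀) = j ∷ j ℕ.+ 1 ∷ []
δ (j , c₁) = j ℕ.+ 2 ∷ []
δ (j , c₂) = j ℕ.+ 2 ∷ j ℕ.+ 3 ∷ []
δ (j , c₃) = j ℕ.+ 3 ∷ j ℕ.+ 3 ∷ []

γ^ : ℕ → List Letter
γ^ n = iterateMorphism γ n (0 , c₀)

image-γ-length : ∀ w → length w ℕ.+ length w ≤ length (image γ w)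
image-γ-length []             = z≤n
image-γ-length (a ∷ w) =
  subst (_≤ length (image γ (a ∷ w))) (cong suc (sym (ℕ.+-suc (length w) (length w))))
    (step a (image-γ-length w))
  where
  step : ∀ a {m} → m ≤ length (image γ w) → suc (suc m) ≤ length (image γ (a ∷ w))
  step (j , c₀) p = s≤s (s≤s p)
  step (j , c₁) p = s≤s (s≤s p)
  step (j , c₂) p = s≤s (s≤s (ℕ.m≤n⇒m≤1+n p))
  step (j , c₃) p = s≤s (s≤s (ℕ.m≤n⇒m≤1+n p))

n<length-γ^ : ∀ n → n < length (γ^ n)
n<length-γ^ zero    = z<s
n<length-γ^ (suc n) = ℕ.≤-trans
  (ℕ.+-mono-≤ (ℕ.≤-trans z<s (n<length-γ^ n)) (n<length-γ^ n))
  (image-γ-length (γ^ n))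

xγ : InfiniteWord Letter
xγ n = lookup (γ^ n) (fromℕ< (n<length-γ^ n))

γ^-extends : ∀ n → ∃ λ u → γ^ (suc n) ≡ γ^ n ++ u
γ^-extends zero    = [ 0 , c₁ ] , refl
γ^-extends (suc n) with γ^-extends n
... | u , eq = image γ u , trans (cong (image γ) eq) (concatMap-++ (toList ∘ γ) (γ^ n) u)

γ^-extends-+ : ∀ k n → ∃ λ u → γ^ (k ℕ.+ n) ≡ γ^ n ++ u
γ^-extends-+ zero    n = [] , sym (++-identityʳ (γ^ n))
γ^-extends-+ (suc k) n with γ^-extends-+ k n | γ^-extends (k ℕ.+ n)
... | u , eq | v , eq′ =
  u ++ v , trans eq′ (trans (cong (_++ v) eq) (++-assoc (γ^ n) u v))

module _ {A : Set} where

  lookup-++-fromℕ< : ∀ (u v w : List A) i (p : i < length u) (q : i < length w) →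
                     w ≡ u ++ v → lookup w (fromℕ< q) ≡ lookup u (fromℕ< p)
  lookup-++-fromℕ< (a ∷ u) v _ zero    _       _       refl = refl
  lookup-++-fromℕ< (a ∷ u) v _ (suc i) (s≤s p) (s≤s q) refl =
    lookup-++-fromℕ< u v (u ++ v) i p q refl

  applyUpTo-lookup : ∀ (w : List A) (x : InfiniteWord A) →
                     (∀ i (p : i < length w) → lookup w (fromℕ< p) ≡ x i) →
                     w ≡ applyUpTo x (length w)
  applyUpTo-lookup []      x h = refl
  applyUpTo-lookup (a ∷ w) x h =
    cong₂ _∷_ (h 0 z<s) (applyUpTo-lookup w (x ∘ suc) (λ i p → h (suc i) (s≤s p)))

xγ-isLimit : IsLimit γ^ xγ
xγ-isLimit = record
  { prefix    = λ n → applyUpTo-lookup (γ^ n) xγ (agree n)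
  ; unbounded = λ k → k , n<length-γ^ k
  }
  where
  agree : ∀ n i (p : i < length (γ^ n)) → lookup (γ^ n) (fromℕ< p) ≡ xγ i
  agree n i p with ℕ.≤-total n i
  ... | inj₁ n≤i with γ^-extends-+ (i ℕ.∸ n) n
  ...   | u , eq = sym (lookup-++-fromℕ< (γ^ n) u (γ^ i) i p (n<length-γ^ i)
                     (trans (cong γ^ (sym (ℕ.m∸n+n≡m n≤i))) eq))
  agree n i p | inj₂ i≤n with γ^-extends-+ (n ℕ.∸ i) i
  ...   | u , eq = lookup-++-fromℕ< (γ^ i) u (γ^ n) i (n<length-γ^ i) p
                     (trans (cong γ^ (sym (ℕ.m∸n+n≡m i≤n))) eq)

{-# OPTIONS --safe #-}

-- Split the natural numbers at the Lucas numbers Lᵢ, where for even i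
-- Lᵢ = φⁱ + φ⁻ⁱ and Lᵢ₊₁ = φⁱ⁺¹ − φ⁻ⁱ⁻¹.  Adding L₂ₙ or L₂ₙ₊₁ to a number of
-- an earlier interval alters only the two ends of its expansion.  At the
-- left end a new leading 1 appears or a leading 10 becomes 1000; at the
-- right end the last 1 is moved by 2φⁱ = φⁱ⁺¹ + φⁱ⁻², φⁱ = φⁱ⁻¹ + φⁱ⁻² and
-- φⁱ − φⁱ⁻¹ = φⁱ⁻².  Hence, for even e,
--   s[Lₑ₊₄ , Lₑ₊₅] = s[0 , Lₑ₊₃] + 2,
--   s]Lₑ₊₅ , Lₑ₊₆[ = (s]Lₑ₊₃ , Lₑ₊₄[ + 1) (s[Lₑ₊₂ , Lₑ₊₃] + 2) (s]Lₑ₊₃ , Lₑ₊₄[ + 1),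
-- which is the recursion satisfied by the words δ(γⁿ(a)): for e = 2n these
-- describe s on [0 , Lₑ[, [Lₑ , Lₑ₊₂[, [Lₑ₊₂ , Lₑ₊₃] and ]Lₑ₊₃ , Lₑ₊₄[ when
-- a has the colour c₀, c₁, c₂ and c₃ respectively.

module Submission where

open import Defs
open import Algebra.Bundles using (CommutativeMonoid)
import Algebra.Solver.CommutativeMonoid as MonoidSolver
open import Data.Digit using (Bit)
open import Data.Fin.Patterns using (0F; 1F)
open import Data.Integer.Base as ℤ using (ℤ; +_; -[1+_])
open import Data.List.Base
  using (List; []; _∷_; _++_; length; concatMap; applyUpTo)
open import Data.List.NonEmpty.Base using (List⁺; _∷_; toList)
open import Data.List.Properties
  using (concatMap-++; concatMap-pure; length-++; ++-identityʳ)
open import Data.List.Relation.Unary.Linked using ([])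
open import Data.Nat.Base as ℕ using (ℕ; zero; suc; _<_; _≤_; z≤n; s≤s)
import Data.Nat.Properties as ℕ
open import Data.Product.Base using (_×_; _,_; ∃)
open import Function.Base using (_∘_)
open import Level using (0ℓ)
open import Relation.Binary.PropositionalEquality

open ≡-Reasoning

-- Digit strings without 11 and their values in `ℤ[φ]`

+-0-commutativeMonoid : CommutativeMonoid 0ℓ 0ℓ
+-0-commutativeMonoid = record
  { Carrier = ℤ[φ] ; _≈_ = _≡_ ; _∙_ = _+_ ; ε = fromℕ 0
  ; isCommutativeMonoid = record
    { isMonoid = record
      { isSemigroup = record
        { isMagma = record { isEquivalence = isEquivalence ; ∙-cong = cong₂ _+_ }
        ; assoc = +-assoc }
      ; identity = +-identityˡ , +-identityʳ }
    ; comm = +-comm }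
  }

open MonoidSolver +-0-commutativeMonoid using (solve; _⊜_; _⊕_)

-- Word i j is a string occupying the positions i, …, j + 1, cut into
-- blocks 0 and 10; such strings can be concatenated freely.

infixr 5 0∷_ 10∷_

data Word : ℤ → ℤ → Set where
  []   : ∀ {i} → Word i i
  0∷_  : ∀ {i j} → Word (ℤ.pred i) j → Word i j
  10∷_ : ∀ {i j} → Word (ℤ.pred (ℤ.pred i)) j → Word i j

⟦_⟧ : ∀ {i j} → Word i j → ℤ[φ]
⟦ [] ⟧           = fromℕ 0
⟦ 0∷ w ⟧         = ⟦ w ⟧
⟦ 10∷_ {i} w ⟧   = φ^ i + ⟦ w ⟧

ones : ∀ {i j} → Word i j → ℕ
ones []       = 0
ones (0∷ w)   = ones w
ones (10∷ w)  = suc (ones w)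

bits : ∀ {i j} → Word i j → List Bit
bits []       = []
bits (0∷ w)   = 0F ∷ bits w
bits (10∷ w)  = 1F ∷ 0F ∷ bits w

bits-no11 : ∀ {i j} (w : Word i j) → No11 (bits w)
bits-no11 []       = []
bits-no11 (0∷ w)   = 0-ok (bits-no11 w)
bits-no11 (10∷ w)  = 10-ok (0-ok (bits-no11 w))

bits-value : ∀ {i j} (w : Word i j) → value i (bits w) ≡ ⟦ w ⟧
bits-value []             = refl
bits-value (0∷_ {i} w)    = trans (value-0∷ i (bits w)) (bits-value w)
bits-value (10∷_ {i} w)   =
  trans (value-1∷ i (0F ∷ bits w))
    (cong (_+_ (φ^ i)) (trans (value-0∷ (ℤ.pred i) (bits w)) (bits-value w)))

bits-digitSum : ∀ {i j} (w : Word i j) → digitSum (bits w) ≡ ones w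
bits-digitSum []       = refl
bits-digitSum (0∷ w)   = bits-digitSum w
bits-digitSum (10∷ w)  = cong suc (bits-digitSum w)

-- By `sβ-unique` any expansion of `N` computes `sβ N`, so surplus zeros at either end are harmless
-- and no canonical string has to be found.
sβ-word : ∀ {i j N} (w : Word i j) → ⟦ w ⟧ ≡ fromℕ N → sβ N ≡ ones w
sβ-word {i} {N = N} w eq =
  trans (sβ-unique N (expansion i (bits w) (bits-no11 w) (trans (bits-value w) eq)))
    (bits-digitSum w)

infixl 5 _∷0 _∷10

_∷0 : ∀ {i j} → Word i j → Word i (ℤ.pred j)
[] ∷0       = 0∷ []
(0∷ w) ∷0   = 0∷ (w ∷0)
(10∷ w) ∷0  = 10∷ (w ∷0)

_∷10 : ∀ {i j} → Word i j → Word i (ℤ.pred (ℤ.pred j))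
[] ∷10       = 10∷ []
(0∷ w) ∷10   = 0∷ (w ∷10)
(10∷ w) ∷10  = 10∷ (w ∷10)

⟦∷0⟧ : ∀ {i j} (w : Word i j) → ⟦ w ∷0 ⟧ ≡ ⟦ w ⟧
⟦∷0⟧ []             = refl
⟦∷0⟧ (0∷ w)         = ⟦∷0⟧ w
⟦∷0⟧ (10∷_ {i} w)   = cong (_+_ (φ^ i)) (⟦∷0⟧ w)

⟦∷10⟧ : ∀ {i j} (w : Word i j) → ⟦ w ∷10 ⟧ ≡ ⟦ w ⟧ + φ^ j
⟦∷10⟧ {i} []             = +-comm (φ^ i) (fromℕ 0)
⟦∷10⟧ (0∷ w)             = ⟦∷10⟧ w
⟦∷10⟧ {j = j} (10∷_ {i} w) =
  trans (cong (_+_ (φ^ i)) (⟦∷10⟧ w)) (sym (+-assoc (φ^ i) ⟦ w ⟧ (φ^ j)))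

ones-∷0 : ∀ {i j} (w : Word i j) → ones (w ∷0) ≡ ones w
ones-∷0 []       = refl
ones-∷0 (0∷ w)   = ones-∷0 w
ones-∷0 (10∷ w)  = cong suc (ones-∷0 w)

ones-∷10 : ∀ {i j} (w : Word i j) → ones (w ∷10) ≡ suc (ones w)
ones-∷10 []       = refl
ones-∷10 (0∷ w)   = ones-∷10 w
ones-∷10 (10∷ w)  = cong suc (ones-∷10 w)

-- Lucas numbers and powers of φ

lucas : ℕ → ℕ
lucas zero          = 2
lucas (suc zero)    = 1
lucas (suc (suc n)) = lucas (suc n) ℕ.+ lucas n

-- Binet's formula Lₙ = φⁿ + (-φ)⁻ⁿ at n = 2 + e and n = 3 + e, for even e. In the odd case the
-- negative term is moved to the left, to stay within sums.
record Binet (e : ℕ) : Set where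
  field
    even : fromℕ (lucas (2 ℕ.+ e)) ≡ φ^ (+ (2 ℕ.+ e)) + φ^ -[1+ 1 ℕ.+ e ]
    odd  : fromℕ (lucas (3 ℕ.+ e)) + φ^ -[1+ 2 ℕ.+ e ] ≡ φ^ (+ (3 ℕ.+ e))

open Binet

binet-step : ∀ {e} → Binet e → Binet (2 ℕ.+ e)
binet-step {e} b = record { even = even′ ; odd = odd′ }
  where
  l m P₂ P₃ P₄ M₂ M₃ M₄ M₅ : ℤ[φ]
  l  = fromℕ (lucas (2 ℕ.+ e))
  m  = fromℕ (lucas (3 ℕ.+ e))
  P₂ = φ^ (+ (2 ℕ.+ e))
  P₃ = φ^ (+ (3 ℕ.+ e))
  P₄ = φ^ (+ (4 ℕ.+ e))
  M₂ = φ^ -[1+ 1 ℕ.+ e ]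
  M₃ = φ^ -[1+ 2 ℕ.+ e ]
  M₄ = φ^ -[1+ 3 ℕ.+ e ]
  M₅ = φ^ -[1+ 4 ℕ.+ e ]
  even′ : m + l ≡ P₄ + M₄
  even′ = begin
    m + l                    ≡⟨ cong (_+_ m) (even b) ⟩
    -- Splitting φ⁻²⁻ᵉ brings out the term φ⁻³⁻ᵉ that `odd b` absorbs.
    m + (P₂ + M₂)            ≡⟨ cong (λ x → m + (P₂ + x)) (φ^-fib -[1+ 2 ℕ.+ e ]) ⟩
    m + (P₂ + (M₃ + M₄))     ≡⟨ solve 4 (λ a b c d → a ⊕ (b ⊕ (c ⊕ d)) ⊜ ((a ⊕ c) ⊕ b) ⊕ d) refl m P₂ M₃ M₄ ⟩
    ((m + M₃) + P₂) + M₄     ≡⟨ cong (λ x → (x + P₂) + M₄) (odd b) ⟩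
    (P₃ + P₂) + M₄           ≡⟨ cong (_+ M₄) (φ^-fib (+ (3 ℕ.+ e))) ⟨
    P₄ + M₄                  ∎
  odd′ : ((m + l) + m) + M₅ ≡ φ^ (+ (5 ℕ.+ e))
  odd′ = begin
    ((m + l) + m) + M₅       ≡⟨ cong (λ x → (x + m) + M₅) even′ ⟩
    ((P₄ + M₄) + m) + M₅     ≡⟨ solve 4 (λ a b c d → ((a ⊕ b) ⊕ c) ⊕ d ⊜ a ⊕ (c ⊕ (b ⊕ d))) refl P₄ M₄ m M₅ ⟩
    P₄ + (m + (M₄ + M₅))     ≡⟨ cong (λ x → P₄ + (m + x)) (φ^-fib -[1+ 3 ℕ.+ e ]) ⟨
    P₄ + (m + M₃)            ≡⟨ cong (_+_ P₄) (odd b) ⟩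
    P₄ + P₃                  ≡⟨ φ^-fib (+ (4 ℕ.+ e)) ⟨
    φ^ (+ (5 ℕ.+ e))         ∎

binet : ∀ n → Binet (n ℕ.* 2)
binet zero    = record { even = refl ; odd = refl }
binet (suc n) = binet-step (binet n)

-- For even e these say that N has an expansion of a shape shared by all
-- numbers in [0 , Lₑ₊₂[, [Lₑ₊₂ , Lₑ₊₃] and ]Lₑ₊₃ , Lₑ₊₄[ respectively, and
-- that s = j + sβ N.  The two ends which the recursion rewrites are kept
-- apart from the word w: a final 1 in EvenBlock, and a leading 10 and a
-- final 01 in OddBlock.

Initial EvenBlock OddBlock : (e j N s : ℕ) → Set
Initial e j N s = ∃ λ (w : Word (+ (1 ℕ.+ e)) -[1+ 3 ℕ.+ e ]) →
  ⟦ w ⟧ ≡ fromℕ N × j ℕ.+ ones w ≡ s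
EvenBlock e j N s = ∃ λ (w : Word (+ (2 ℕ.+ e)) -[1+ 1 ℕ.+ e ]) →
  ⟦ w ⟧ + φ^ -[1+ 1 ℕ.+ e ] ≡ fromℕ N × j ℕ.+ suc (ones w) ≡ s
OddBlock e j N s = ∃ λ (w : Word (+ (1 ℕ.+ e)) -[1+ 2 ℕ.+ e ]) →
  φ^ (+ (3 ℕ.+ e)) + (⟦ w ⟧ + φ^ -[1+ 3 ℕ.+ e ]) ≡ fromℕ N × j ℕ.+ (2 ℕ.+ ones w) ≡ s

Initial⇒sβ : ∀ {e N s} → Initial e 0 N s → s ≡ sβ N
Initial⇒sβ (w , v , p) = trans (sym p) (sym (sβ-word w v))

-- Adding Lucas numbers to expansions

module _ {e j N s : ℕ} where

  initial→initial : Initial e j N s → Initial (2 ℕ.+ e) j N s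
  initial→initial (w , v , p) =
    0∷ 0∷ (w ∷0 ∷0)
    , trans (⟦∷0⟧ (w ∷0)) (trans (⟦∷0⟧ w) v)
    , trans (cong (j ℕ.+_) (trans (ones-∷0 (w ∷0)) (ones-∷0 w))) p

  even→initial : EvenBlock e j N s → Initial (2 ℕ.+ e) j N s
  even→initial (w , v , p) =
    0∷ (w ∷10 ∷0 ∷0)
    , trans (⟦∷0⟧ (w ∷10 ∷0)) (trans (⟦∷0⟧ (w ∷10)) (trans (⟦∷10⟧ w) v))
    , trans (cong (j ℕ.+_)
        (trans (ones-∷0 (w ∷10 ∷0)) (trans (ones-∷0 (w ∷10)) (ones-∷10 w)))) p

  odd→initial : OddBlock e j N s → Initial (2 ℕ.+ e) j N s
  odd→initial (w , v , p) =
    10∷ (w ∷0 ∷10)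
    , trans (cong (_+_ (φ^ (+ (3 ℕ.+ e))))
        (trans (⟦∷10⟧ (w ∷0)) (cong (_+ φ^ -[1+ 3 ℕ.+ e ]) (⟦∷0⟧ w)))) v
    , trans (cong (λ k → j ℕ.+ suc k) (trans (ones-∷10 (w ∷0)) (cong suc (ones-∷0 w)))) p

  -- The powers in Lₑ₊₄ stand at 4 + e and -4 - e, beyond both ends of `w`, so nothing carries and
  -- two ones are gained.
  initial→even : Binet e → Initial e (j ℕ.+ 2) N s →
                 EvenBlock (2 ℕ.+ e) j (lucas (4 ℕ.+ e) ℕ.+ N) s
  initial→even b (w , v , p) =
    10∷ 0∷ w
    , (begin
      (P₄ + ⟦ w ⟧) + M₄        ≡⟨ solve 3 (λ a b c → (a ⊕ b) ⊕ c ⊜ (a ⊕ c) ⊕ b) refl P₄ ⟦ w ⟧ M₄ ⟩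
      (P₄ + M₄) + ⟦ w ⟧        ≡⟨ cong₂ _+_ (sym (even (binet-step b))) v ⟩
      fromℕ (lucas (4 ℕ.+ e)) + fromℕ N ∎)
    , trans (sym (ℕ.+-assoc j 2 (ones w))) p
    where
    P₄ = φ^ (+ (4 ℕ.+ e))
    M₄ = φ^ -[1+ 3 ℕ.+ e ]

  -- Again no carry: the old final 1 at -2 - e becomes an interior 10, and the new final 1 stands
  -- two places to its right.
  even→even : Binet e → EvenBlock e (j ℕ.+ 2) N s →
              EvenBlock (2 ℕ.+ e) j (lucas (4 ℕ.+ e) ℕ.+ N) s
  even→even b (w , v , p) =
    10∷ (w ∷10)
    , (begin
      (P₄ + ⟦ w ∷10 ⟧) + M₄    ≡⟨ solve 3 (λ a b c → (a ⊕ b) ⊕ c ⊜ (a ⊕ c) ⊕ b) refl P₄ ⟦ w ∷10 ⟧ M₄ ⟩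
      (P₄ + M₄) + ⟦ w ∷10 ⟧    ≡⟨ cong₂ _+_ (sym (even (binet-step b))) (trans (⟦∷10⟧ w) v) ⟩
      fromℕ (lucas (4 ℕ.+ e)) + fromℕ N ∎)
    , trans (cong (λ k → j ℕ.+ (2 ℕ.+ k)) (ones-∷10 w))
        (trans (sym (ℕ.+-assoc j 2 _)) p)
    where
    P₄ = φ^ (+ (4 ℕ.+ e))
    M₄ = φ^ -[1+ 3 ℕ.+ e ]

  -- The two leading powers merge into φᵉ⁺⁵, while 2φ⁻⁴⁻ᵉ becomes φ⁻³⁻ᵉ + φ⁻⁶⁻ᵉ; the merger is why
  -- only one 1 is gained.
  odd→odd₁ : Binet e → OddBlock e (j ℕ.+ 1) N s →
             OddBlock (2 ℕ.+ e) j (lucas (4 ℕ.+ e) ℕ.+ N) s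
  odd→odd₁ b (w , v , p) =
    0∷ 0∷ (w ∷10)
    , (begin
      P₅ + (⟦ w ∷10 ⟧ + M₆)
        ≡⟨ cong₂ (λ x y → x + (y + M₆)) (φ^-fib (+ (4 ℕ.+ e))) (⟦∷10⟧ w) ⟩
      (P₄ + P₃) + ((⟦ w ⟧ + M₃) + M₆)
        ≡⟨ solve 5 (λ a b c d f → (a ⊕ b) ⊕ ((c ⊕ d) ⊕ f) ⊜ ((a ⊕ b) ⊕ c) ⊕ (d ⊕ f)) refl P₄ P₃ ⟦ w ⟧ M₃ M₆ ⟩
      ((P₄ + P₃) + ⟦ w ⟧) + (M₃ + M₆)
        ≡⟨ cong (_+_ ((P₄ + P₃) + ⟦ w ⟧)) (twice -[1+ 3 ℕ.+ e ]) ⟩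
      ((P₄ + P₃) + ⟦ w ⟧) + (M₄ + M₄)
        ≡⟨ solve 4 (λ a b c d → ((a ⊕ b) ⊕ c) ⊕ (d ⊕ d) ⊜ (a ⊕ d) ⊕ (b ⊕ (c ⊕ d))) refl P₄ P₃ ⟦ w ⟧ M₄ ⟩
      (P₄ + M₄) + (P₃ + (⟦ w ⟧ + M₄))
        ≡⟨ cong₂ _+_ (sym (even (binet-step b))) v ⟩
      fromℕ (lucas (4 ℕ.+ e)) + fromℕ N ∎)
    , trans (cong (λ k → j ℕ.+ (2 ℕ.+ k)) (ones-∷10 w))
        (trans (sym (ℕ.+-assoc j 1 _)) p)
    where
    P₃ = φ^ (+ (3 ℕ.+ e))
    P₄ = φ^ (+ (4 ℕ.+ e))
    P₅ = φ^ (+ (5 ℕ.+ e))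
    M₃ = φ^ -[1+ 2 ℕ.+ e ]
    M₄ = φ^ -[1+ 3 ℕ.+ e ]
    M₆ = φ^ -[1+ 5 ℕ.+ e ]

  -- Adding Lₑ₊₅ subtracts φ⁻⁵⁻ᵉ. Expanding the final φ⁻²⁻ᵉ into φ⁻³⁻ᵉ + φ⁻⁵⁻ᵉ + φ⁻⁶⁻ᵉ exposes the
  -- term to cancel.
  even→odd : Binet e → EvenBlock e (j ℕ.+ 2) N s →
             OddBlock (2 ℕ.+ e) j (lucas (5 ℕ.+ e) ℕ.+ N) s
  even→odd b (w , v , p) =
    0∷ (w ∷0 ∷10)
    , (begin
      P₅ + (⟦ w ∷0 ∷10 ⟧ + M₆)
        ≡⟨ cong₂ (λ x y → x + (y + M₆)) (sym (odd (binet-step b)))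
             (trans (⟦∷10⟧ (w ∷0)) (cong (_+ M₃) (⟦∷0⟧ w))) ⟩
      (m + M₅) + ((⟦ w ⟧ + M₃) + M₆)
        ≡⟨ solve 5 (λ a b c d f → (a ⊕ b) ⊕ ((c ⊕ d) ⊕ f) ⊜ a ⊕ (c ⊕ (d ⊕ (b ⊕ f)))) refl m M₅ ⟦ w ⟧ M₃ M₆ ⟩
      m + (⟦ w ⟧ + (M₃ + (M₅ + M₆)))
        ≡⟨ cong (λ x → m + (⟦ w ⟧ + (M₃ + x))) (φ^-fib -[1+ 4 ℕ.+ e ]) ⟨
      m + (⟦ w ⟧ + (M₃ + M₄))
        ≡⟨ cong (λ x → m + (⟦ w ⟧ + x)) (φ^-fib -[1+ 2 ℕ.+ e ]) ⟨
      m + (⟦ w ⟧ + M₂)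
        ≡⟨ cong (_+_ m) v ⟩
      m + fromℕ N ∎)
    , trans (cong (λ k → j ℕ.+ (2 ℕ.+ k)) (trans (ones-∷10 (w ∷0)) (cong suc (ones-∷0 w))))
        (trans (sym (ℕ.+-assoc j 2 _)) p)
    where
    m  = fromℕ (lucas (5 ℕ.+ e))
    P₅ = φ^ (+ (5 ℕ.+ e))
    M₂ = φ^ -[1+ 1 ℕ.+ e ]
    M₃ = φ^ -[1+ 2 ℕ.+ e ]
    M₄ = φ^ -[1+ 3 ℕ.+ e ]
    M₅ = φ^ -[1+ 4 ℕ.+ e ]
    M₆ = φ^ -[1+ 5 ℕ.+ e ]

  -- The final φ⁻⁴⁻ᵉ loses φ⁻⁵⁻ᵉ and leaves φ⁻⁶⁻ᵉ. The old leading 1, two places below the new one,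
  -- moves into the word.
  odd→odd₂ : Binet e → OddBlock e (j ℕ.+ 1) N s →
             OddBlock (2 ℕ.+ e) j (lucas (5 ℕ.+ e) ℕ.+ N) s
  odd→odd₂ b (w , v , p) =
    10∷ (w ∷0 ∷0)
    , (begin
      P₅ + ((P₃ + ⟦ w ∷0 ∷0 ⟧) + M₆)
        ≡⟨ cong₂ (λ x y → x + ((P₃ + y) + M₆)) (sym (odd (binet-step b)))
             (trans (⟦∷0⟧ (w ∷0)) (⟦∷0⟧ w)) ⟩
      (m + M₅) + ((P₃ + ⟦ w ⟧) + M₆)
        ≡⟨ solve 5 (λ a b c d f → (a ⊕ b) ⊕ ((c ⊕ d) ⊕ f) ⊜ a ⊕ (c ⊕ (d ⊕ (b ⊕ f)))) refl m M₅ P₃ ⟦ w ⟧ M₆ ⟩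
      m + (P₃ + (⟦ w ⟧ + (M₅ + M₆)))
        ≡⟨ cong (λ x → m + (P₃ + (⟦ w ⟧ + x))) (φ^-fib -[1+ 4 ℕ.+ e ]) ⟨
      m + (P₃ + (⟦ w ⟧ + M₄))
        ≡⟨ cong (_+_ m) v ⟩
      m + fromℕ N ∎)
    , trans (cong (λ k → j ℕ.+ (3 ℕ.+ k)) (trans (ones-∷0 (w ∷0)) (ones-∷0 w)))
        (trans (sym (ℕ.+-assoc j 1 _)) p)
    where
    m  = fromℕ (lucas (5 ℕ.+ e))
    P₃ = φ^ (+ (3 ℕ.+ e))
    P₅ = φ^ (+ (5 ℕ.+ e))
    M₄ = φ^ -[1+ 3 ℕ.+ e ]
    M₅ = φ^ -[1+ 4 ℕ.+ e ]
    M₆ = φ^ -[1+ 5 ℕ.+ e ]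

-- Lists of values along intervals of numbers

data Segment (P : ℕ → ℕ → Set) : ℕ → ℕ → List ℕ → Set where
  []  : ∀ {a} → Segment P a a []
  _∷_ : ∀ {a b s u} → P a s → Segment P (suc a) b u → Segment P a b (s ∷ u)

infixr 5 _⊙_

-- The endpoints in the type certify that the pieces meet, so word lengths need never be computed.
_⊙_ : ∀ {P a b c u v} → Segment P a b u → Segment P b c v → Segment P a c (u ++ v)
[]      ⊙ q = q
(x ∷ p) ⊙ q = x ∷ (p ⊙ q)

segment-map : ∀ {P Q a b u} → (∀ {N s} → P N s → Q N s) → Segment P a b u → Segment Q a b u
segment-map f []      = []
segment-map f (x ∷ p) = f x ∷ segment-map f p

segment-shift : ∀ {P Q a b u} k → (∀ {N s} → P N s → Q (k ℕ.+ N) s) →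
                Segment P a b u → Segment Q (k ℕ.+ a) (k ℕ.+ b) u
segment-shift k f []                = []
segment-shift {Q = Q} {b = b} k f (_∷_ {a} {u = u} x p) =
  f x ∷ subst (λ c → Segment Q c (k ℕ.+ b) u) (ℕ.+-suc k a) (segment-shift k f p)

segment-at : ∀ {P a b} f m {i} → Segment P a b (applyUpTo f m) → i < m → P (a ℕ.+ i) (f i)
segment-at {P} {a} f (suc m) {zero} (x ∷ p) _ =
  subst (λ c → P c (f 0)) (sym (ℕ.+-identityʳ a)) x
segment-at {P} {a} f (suc m) {suc i} (x ∷ p) (s≤s i<m) =
  subst (λ c → P c (f (suc i))) (sym (ℕ.+-suc a i)) (segment-at (f ∘ suc) m p i<m)

-- Morphisms on finite and infinite words

module _ {A B : Set} where

  concatMap-concatMap : ∀ {C : Set} (g : B → List C) (f : A → List B) u →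
    concatMap g (concatMap f u) ≡ concatMap (concatMap g ∘ f) u
  concatMap-concatMap g f []      = refl
  concatMap-concatMap g f (a ∷ u) =
    trans (concatMap-++ g (f a) (concatMap f u))
      (cong (concatMap g (f a) ++_) (concatMap-concatMap g f u))

  -- Here `u` is the unread rest of an image, as in the recursion of `prependImage`; the case of
  -- empty `u` alone would not be inductive.
  prependImage-prefix : ∀ u (f : Morphism A B) x k →
    let w = u ++ image f (applyUpTo x k) in w ≡ applyUpTo (prependImage u f x) (length w)
  prependImage-prefix (b ∷ u) f x k       = cong (b ∷_) (prependImage-prefix u f x k)
  prependImage-prefix []      f x zero    = refl
  prependImage-prefix []      f x (suc k) =
    cong (List⁺.head (f (x 0)) ∷_) (prependImage-prefix (List⁺.tail (f (x 0))) f (x ∘ suc) k)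

  length-image : ∀ (f : Morphism A B) w → length w ≤ length (image f w)
  length-image f []      = z≤n
  length-image f (a ∷ w) = s≤s (subst (length w ≤_) (sym (length-++ (List⁺.tail (f a))))
    (ℕ.≤-trans (length-image f w) (ℕ.m≤n+m _ (length (List⁺.tail (f a))))))

-- The definition applies `f` outermost; peeling off the innermost application instead splits the
-- word along the letters of `f a`, as the recursion on intervals requires.
iterateMorphism-suc : ∀ {A : Set} (f : Morphism A A) n a →
  iterateMorphism f (suc n) a ≡ concatMap (iterateMorphism f n) (toList (f a))
iterateMorphism-suc f zero    a =
  trans (++-identityʳ (toList (f a))) (sym (concatMap-pure (toList (f a))))
iterateMorphism-suc f (suc n) a =
  trans (cong (image f) (iterateMorphism-suc f n a))
    (concatMap-concatMap (toList ∘ f) (iterateMorphism f n) (toList (f a)))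

δγ^ : ℕ → Letter → List ℕ
δγ^ n a = image δ (iterateMorphism γ n a)

δγ^-suc : ∀ n a → δγ^ (suc n) a ≡ concatMap (δγ^ n) (toList (γ a))
δγ^-suc n a =
  trans (cong (image δ) (iterateMorphism-suc γ n a))
    (concatMap-concatMap (toList ∘ δ) (iterateMorphism γ n) (toList (γ a)))

-- Induction over the Lucas intervals

record Blocks (n j : ℕ) : Set where
  private e = n ℕ.* 2
  field
    block₀ : Segment (Initial e j) 0 (lucas e) (δγ^ n (j , c₀))
    block₁ : Segment (Initial e j) (lucas e) (lucas (2 ℕ.+ e)) (δγ^ n (j , c₁))
    block₂ : Segment (EvenBlock e j) (lucas (2 ℕ.+ e)) (suc (lucas (3 ℕ.+ e))) (δγ^ n (j , c₂))
    block₃ : Segment (OddBlock e j) (suc (lucas (3 ℕ.+ e))) (lucas (4 ℕ.+ e)) (δγ^ n (j , c₃))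

open Blocks

blocks-zero : ∀ j → Blocks 0 j
blocks-zero j = record
  -- The expansions used are 0, 1, 2 = φ + φ⁻², 3 = φ² + φ⁻², 4 = φ² + 1 + φ⁻², 5 = φ³ + φ⁻¹ + φ⁻⁴
  -- and 6 = φ³ + φ + φ⁻⁴.
  { block₀ = (0∷ 0∷ 0∷ 0∷ 0∷ [] , refl , ℕ.+-identityʳ j)
           ∷ (0∷ 10∷ 0∷ 0∷ [] , refl , refl) ∷ []
  ; block₁ = (10∷ 0∷ 10∷ [] , refl , refl) ∷ []
  ; block₂ = (10∷ 0∷ 0∷ [] , refl , refl) ∷ (10∷ 10∷ [] , refl , refl) ∷ []
  ; block₃ = (0∷ 0∷ 10∷ [] , refl , refl) ∷ (10∷ 0∷ 0∷ [] , refl , refl) ∷ []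
  }

-- All `j` are needed at once, since `γ` raises `j` by the number of ones that adding a Lucas number
-- creates.
blocks-suc : ∀ n → (∀ j → Blocks n j) → ∀ j → Blocks (suc n) j
blocks-suc n bs j = record
  { block₀ = subst (Segment _ _ _) (sym (δγ^-suc n (j , c₀)))
      (segment-map initial→initial (block₀ (bs j))
       ⊙ segment-map initial→initial (block₁ (bs j)) ⊙ [])
  ; block₁ = subst (Segment _ _ _) (sym (δγ^-suc n (j , c₁)))
      (segment-map even→initial (block₂ (bs j))
       ⊙ segment-map odd→initial (block₃ (bs j)) ⊙ [])
  ; block₂ = subst₂ (λ a b → Segment (EvenBlock (2 ℕ.+ e) j) a b (δγ^ (suc n) (j , c₂)))
      (ℕ.+-identityʳ L₄) (ℕ.+-suc L₄ L₃)
      (subst (Segment _ _ _) (sym (δγ^-suc n (j , c₂)))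
        (segment-shift L₄ (initial→even (binet n)) (block₀ (bs (j ℕ.+ 2)))
         ⊙ segment-shift L₄ (initial→even (binet n)) (block₁ (bs (j ℕ.+ 2)))
         ⊙ segment-shift L₄ (even→even (binet n)) (block₂ (bs (j ℕ.+ 2))) ⊙ []))
  ; block₃ = subst (λ a → Segment (OddBlock (2 ℕ.+ e) j) a (L₅ ℕ.+ L₄) (δγ^ (suc n) (j , c₃)))
      (ℕ.+-suc L₄ L₃)
      (subst (Segment _ _ _) (sym (δγ^-suc n (j , c₃)))
        (segment-shift L₄ (odd→odd₁ (binet n)) (block₃ (bs (j ℕ.+ 1)))
         -- The first two pieces meet because Lₑ₊₄ + Lₑ₊₄ = Lₑ₊₅ + Lₑ₊₂.
         ⊙ subst (λ a → Segment (OddBlock (2 ℕ.+ e) j) a (L₅ ℕ.+ suc L₃) (δγ^ n (j ℕ.+ 2 , c₂)))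
             (ℕ.+-assoc L₄ L₃ (lucas (2 ℕ.+ e)))
             (segment-shift L₅ (even→odd (binet n)) (block₂ (bs (j ℕ.+ 2))))
         ⊙ segment-shift L₅ (odd→odd₂ (binet n)) (block₃ (bs (j ℕ.+ 1))) ⊙ []))
  }
  where
  e L₃ L₄ L₅ : ℕ
  e  = n ℕ.* 2
  L₃ = lucas (3 ℕ.+ e)
  L₄ = lucas (4 ℕ.+ e)
  L₅ = lucas (5 ℕ.+ e)

blocks : ∀ n j → Blocks n j
blocks zero    = blocks-zero
blocks (suc n) = blocks-suc n (blocks n)

theorem5 : imageω δ xγ ≗ sβ
-- `N` iterations suffice: `γ^ N` has more than `N` letters and `δ` erases none. At j = 0 the
-- entries of `block₀` are the values of `sβ` themselves.
theorem5 N = Initial⇒sβ {e = N ℕ.* 2}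
  (segment-at (imageω δ xγ) (length (δγ^ N a))
    (subst (Segment _ _ _) prefix (block₀ (blocks N 0)))
    (ℕ.<-≤-trans (n<length-γ^ N) (length-image δ (γ^ N))))
  where
  a : Letter
  a = 0 , c₀
  prefix : δγ^ N a ≡ applyUpTo (imageω δ xγ) (length (δγ^ N a))
  prefix = subst (λ w → image δ w ≡ applyUpTo (imageω δ xγ) (length (image δ w)))
    (sym (IsLimit.prefix xγ-isLimit N))
    (prependImage-prefix [] δ xγ (length (γ^ N)))
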